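{- $s'_{3,3}(m)=m+O(1)$ as $m\to\infty$.
   Context: All graphs are finite and simple. For an integer $t\ge1$, a $(3,t)'$-system is a pair $(H,\mathcal{F})$ where $H$ is a triangle-free graph and $\mathcal{F}$ is a family (without repeated elements) of subsets of $V(H)$, each of size exactly $t$, such that every $S\in\mathcal{F}$ is a maximal independent set of $H$ (independent, and every vertex outside $S$ has a neighbour in $S$). No intersection condition is imposed. For integers $m\ge0$, $s'_{3,t}(m)$ is the maximum of $|\mathcal{F}|$ over all $(3,t)'$-systems $(H,\mathcal{F})$ with $|V(H)|=m$. -}

module Defs where

open import Data.Nat using (ℕ; _+_; _≤_)
open import Data.Bool using (Bool; true; false)
open import Data.Fin using (Fin)
open import Data.Fin.Subset using (Subset; _∈_; _∉_; ∣_∣)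
open import Data.List using (List; length)
open import Data.List.Relation.Unary.All using (All)
open import Data.List.Relation.Unary.Unique.Propositional using (Unique)
open import Data.Product using (_×_; ∃; Σ)
open import Data.Empty using (⊥)
open import Relation.Nullary using (¬_)
open import Relation.Binary.PropositionalEquality using (_≡_)

record Graph (m : ℕ) : Set where
  field
    adj     : Fin m → Fin m → Bool
    adj-sym : ∀ i j → adj i j ≡ adj j i
    irrefl  : ∀ i → adj i i ≡ false
open Graph public

Edge : ∀ {m} → Graph m → Fin m → Fin m → Set
Edge G i j = adj G i j ≡ true

TriangleFree : ∀ {m} → Graph m → Set
TriangleFree G = ∀ i j k → Edge G i j → Edge G j k → Edge G i k → ⊥

Independent : ∀ {m} → Graph m → Subset m → Set
Independent G S = ∀ i j → i ∈ S → j ∈ S → ¬ Edge G i j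

MaximalIndependent : ∀ {m} → Graph m → Subset m → Set
MaximalIndependent G S =
  Independent G S × (∀ v → v ∉ S → ∃ λ u → u ∈ S × Edge G v u)

record System′ (t m : ℕ) : Set where
  field
    graph    : Graph m
    triFree  : TriangleFree graph
    family   : List (Subset m)
    distinct : Unique family
    sizes    : All (λ S → ∣ S ∣ ≡ t) family
    maxIndep : All (MaximalIndependent graph) family
open System′ public

{-# OPTIONS --safe #-}

-- Lower bound: join two vertices of {0, …, m−1} when their distance is odd and at least 3; every
-- {i, i+1, i+2} is then a maximal independent set.
--
-- Upper bound.  Let d(v) be the number of members of the family through v.  If d ≤ 3 everywhere,
-- double counting gives at most m sets.  Otherwise take four sets through one vertex a.  A set is
-- determined by its part outside N(a), because N(a) is independent.
--   * If two of the four share a second vertex, a has at most 5 non-neighbours, so there are at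
--     most 2⁶ sets.
--   * If not, the four pairs {yᵢ, zᵢ} completing a form a crown (yᵢ ~ zⱼ iff i ≠ j), which forces
--     the non-neighbours of a to split into two independent sides, and every set of the family can
--     be charged injectively to a vertex.  The delicate sets have one vertex in N(a) and one on
--     each side: such transversals of three independent classes always have a vertex lying in no
--     other transversal.
module Submission where

open import Defs
open import Data.Bool using (Bool; true; false; not)
import Data.Bool.Properties as Bool
open import Data.Empty using (⊥; ⊥-elim)
open import Data.Fin using (Fin; zero; suc; toℕ; inject≤; _≟_; funToFin; finToFun)
open import Data.Fin.Properties using (any?; all?; injective⇒≤; inject≤-injective; finToFun-funToFin; ¬∀⟶∃¬)
open import Data.Fin.Subset using (Subset; inside; outside; _∈_; _∉_; ∣_∣; _-_; Nonempty) renaming (⊥ to ∅)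
open import Data.Fin.Subset.Properties using (∣⊥∣≡0; ∉⊥; _∈?_; p─q⊆p; x∈p∧x≢y⇒x∈p-y; ⊆-antisym; p─⊥≡p)
open import Data.List as List using (List; []; _∷_; length; map; filter; tabulate)
open import Data.List.Membership.Propositional using (find; lose) renaming (_∈_ to _∈ₗ_)
open import Data.List.Properties using (length-tabulate)
open import Data.List.Relation.Unary.All as All using (All; []; _∷_)
import Data.List.Relation.Unary.All.Properties as All
open import Data.List.Relation.Unary.AllPairs using (_∷_)
open import Data.List.Relation.Unary.Any as Any using (Any)
open import Data.List.Relation.Unary.Unique.Propositional using (Unique)
import Data.List.Relation.Unary.Unique.Propositional.Properties as Unique
open import Data.Nat using (ℕ; zero; suc; _+_; _*_; _^_; _≤_; _≤?_; z≤n; s≤s)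
open import Data.Nat.ListAction using (sum)
open import Data.Nat.Properties using (suc-injective; ≤-reflexive; ≤-trans; ≰⇒>; m≤m+n; m≤n+m; +-comm; +-mono-≤; +-monoʳ-≤; *-cancelʳ-≤; +-commutativeSemigroup)
open import Algebra.Properties.CommutativeSemigroup +-commutativeSemigroup using (x∙yz≈y∙xz)
open import Data.Product using (_×_; _,_; ∃; ∃₂; proj₁; proj₂)
open import Data.Sum using (_⊎_; inj₁; inj₂)
open import Data.Vec using ([]; _∷_; here; there; tail; lookup)
open import Data.Vec.Properties using (≡-dec; []=⇒lookup; lookup⇒[]=)
open import Relation.Nullary using (¬_; Dec; yes; no; ¬?; _×-dec_; _→-dec_)
open import Relation.Nullary.Decidable using (map′; from-yes)
open import Relation.Binary.PropositionalEquality using (_≡_; _≢_; refl; sym; trans; cong; cong₂; subst; ≢-sym)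

-- The lower bound: intervals of length three in the odd-distance graph.

odd : ℕ → Bool
odd zero    = false
odd (suc n) = not (odd n)

oddFrom3 : ℕ → Bool
oddFrom3 zero          = false
oddFrom3 (suc zero)    = false
oddFrom3 (suc (suc n)) = odd n

-- This is `oddFrom3` of the distance. Cancelling successors on both sides makes translation by one
-- hold definitionally, which the inductions on the position of an interval use.
far : ℕ → ℕ → Bool
far zero    n       = oddFrom3 n
far (suc k) zero    = oddFrom3 (suc k)
far (suc k) (suc n) = far k n

far-sym : ∀ k n → far k n ≡ far n k
far-sym zero    zero    = refl
far-sym zero    (suc n) = refl
far-sym (suc k) zero    = refl
far-sym (suc k) (suc n) = far-sym k n

far-irrefl : ∀ k → far k k ≡ false
far-irrefl zero    = refl
far-irrefl (suc k) = far-irrefl k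

oddFrom3⇒odd : ∀ n → oddFrom3 n ≡ true → odd n ≡ true
oddFrom3⇒odd (suc (suc n)) e rewrite e = refl

far⇒parity : ∀ k n → far k n ≡ true → odd k ≢ odd n
far⇒parity zero    n       e q with trans q (oddFrom3⇒odd n e)
... | ()
far⇒parity (suc k) zero    e q with trans (sym q) (oddFrom3⇒odd (suc k) e)
... | ()
far⇒parity (suc k) (suc n) e q = far⇒parity k n e (not-inj q)
  where
  not-inj : ∀ {x y} → not x ≡ not y → x ≡ y
  not-inj {true}  {true}  _ = refl
  not-inj {false} {false} _ = refl

three-parities : ∀ (x y z : Bool) → x ≢ y → y ≢ z → x ≡ z
three-parities true  _     true  _ _ = refl
three-parities false _     false _ _ = refl
three-parities true  true  false p _ = ⊥-elim (p refl)
three-parities true  false false _ q = ⊥-elim (q refl)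
three-parities false true  true  _ q = ⊥-elim (q refl)
three-parities false false true  p _ = ⊥-elim (p refl)

farGraph : ∀ m → Graph m
farGraph m = record
  { adj     = λ i j → far (toℕ i) (toℕ j)
  ; adj-sym = λ i j → far-sym (toℕ i) (toℕ j)
  ; irrefl  = λ i → far-irrefl (toℕ i)
  }

-- Every edge changes parity, and there are only two parities.
farGraph-triangleFree : ∀ m → TriangleFree (farGraph m)
farGraph-triangleFree m i j k ij jk ik =
  far⇒parity (toℕ i) (toℕ k) ik
    (three-parities _ _ _ (far⇒parity (toℕ i) (toℕ j) ij) (far⇒parity (toℕ j) (toℕ k) jk))

interval : ∀ {k} → Fin k → Subset (2 + k)
interval zero    = inside ∷ inside ∷ inside ∷ ∅
interval (suc i) = outside ∷ interval i

interval-injective : ∀ {k} {i j : Fin k} → interval i ≡ interval j → i ≡ j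
interval-injective {i = zero}  {zero}  _ = refl
interval-injective {i = suc i} {suc j} e = cong suc (interval-injective (cong tail e))

∣interval∣ : ∀ {k} (i : Fin k) → ∣ interval i ∣ ≡ 3
∣interval∣ {suc k} zero = cong (3 +_) (∣⊥∣≡0 k)
∣interval∣ (suc i) = ∣interval∣ i

interval-independent : ∀ {k} (i : Fin k) → Independent (farGraph _) (interval i)
interval-independent zero zero zero _ _ ()
interval-independent zero zero (suc zero) _ _ ()
interval-independent zero zero (suc (suc zero)) _ _ ()
interval-independent zero (suc zero) zero _ _ ()
interval-independent zero (suc zero) (suc zero) _ _ ()
interval-independent zero (suc zero) (suc (suc zero)) _ _ ()
interval-independent zero (suc (suc zero)) zero _ _ ()
interval-independent zero (suc (suc zero)) (suc zero) _ _ ()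
interval-independent zero (suc (suc zero)) (suc (suc zero)) _ _ ()
interval-independent zero (suc (suc (suc u))) _ (there (there (there u∈))) _ _ = ∉⊥ u∈
interval-independent zero _ (suc (suc (suc v))) _ (there (there (there v∈))) _ = ∉⊥ v∈
interval-independent (suc i) (suc u) (suc v) (there u∈) (there v∈) e =
  interval-independent i u v u∈ v∈ e

second∈interval : ∀ {k} (i : Fin k) → ∃ λ u → u ∈ interval i × toℕ u ≡ suc (toℕ i)
second∈interval zero    = suc zero , there here , refl
second∈interval (suc i) with second∈interval i
... | u , u∈ , e = suc u , there u∈ , cong suc e

third∈interval : ∀ {k} (i : Fin k) → ∃ λ u → u ∈ interval i × toℕ u ≡ suc (suc (toℕ i))
third∈interval zero    = suc (suc zero) , there (there here) , refl
third∈interval (suc i) with third∈interval i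
... | u , u∈ , e = suc u , there u∈ , cong suc e

-- Apart from the element nearest to `v`, the interval has two elements, at consecutive distances of
-- at least 2 from `v`. One of these distances is odd, hence at least 3.
interval-dominating : ∀ {k} (i : Fin k) v → v ∉ interval i →
                      ∃ λ u → u ∈ interval i × Edge (farGraph _) v u
interval-dominating zero zero v∉ = ⊥-elim (v∉ here)
interval-dominating zero (suc zero) v∉ = ⊥-elim (v∉ (there here))
interval-dominating zero (suc (suc zero)) v∉ = ⊥-elim (v∉ (there (there here)))
interval-dominating zero (suc (suc (suc v))) _ with odd (toℕ v) in e
... | true  = suc zero , there here , e
... | false = zero , here , cong not e
interval-dominating (suc i) zero _ with odd (toℕ i) in e
... | true  with second∈interval i
...   | u , u∈ , q = suc u , there u∈ , trans (cong (λ n → oddFrom3 (suc n)) q) e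
interval-dominating (suc i) zero _ | false with third∈interval i
...   | u , u∈ , q = suc u , there u∈ , trans (cong (λ n → oddFrom3 (suc n)) q) (cong not e)
interval-dominating (suc i) (suc v) v∉ with interval-dominating i v (λ v∈ → v∉ (there v∈))
... | u , u∈ , e = suc u , there u∈ , e

intervalSystem : ∀ k → System′ 3 (2 + k)
intervalSystem k = record
  { graph    = farGraph (2 + k)
  ; triFree  = farGraph-triangleFree (2 + k)
  ; family   = tabulate interval
  ; distinct = Unique.tabulate⁺ interval-injective
  ; sizes    = All.tabulate⁺ ∣interval∣
  ; maxIndep = All.tabulate⁺ λ i → interval-independent i , interval-dominating i
  }

-- Finite sets, injections and double counting.

∣p∣≡0⇒x∉p : ∀ {n} (p : Subset n) {x} → ∣ p ∣ ≡ 0 → x ∉ p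
∣p∣≡0⇒x∉p (outside ∷ p) e (there x∈p) = ∣p∣≡0⇒x∉p p e x∈p

∣p∣≡suc⇒Nonempty : ∀ {n k} (p : Subset n) → ∣ p ∣ ≡ suc k → Nonempty p
∣p∣≡suc⇒Nonempty (inside ∷ p)  _ = zero , here
∣p∣≡suc⇒Nonempty (outside ∷ p) e with ∣p∣≡suc⇒Nonempty p e
... | x , x∈p = suc x , there x∈p

x∈p⇒1+∣p-x∣≡∣p∣ : ∀ {n} (p : Subset n) {x} → x ∈ p → suc ∣ p - x ∣ ≡ ∣ p ∣
x∈p⇒1+∣p-x∣≡∣p∣ (inside ∷ p) here = cong (λ q → suc ∣ q ∣) (p─⊥≡p p)
x∈p⇒1+∣p-x∣≡∣p∣ (inside ∷ p)  (there x∈p) = cong suc (x∈p⇒1+∣p-x∣≡∣p∣ p x∈p)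
x∈p⇒1+∣p-x∣≡∣p∣ (outside ∷ p) (there x∈p) = x∈p⇒1+∣p-x∣≡∣p∣ p x∈p

x∉p-x : ∀ {n} (p : Subset n) x → x ∉ p - x
x∉p-x (_ ∷ p) (suc x) (there x∈) = x∉p-x p x x∈

lookup-member : ∀ {A : Set} {P : A → Set} {xs : List A} → All P xs → ∀ i → P (List.lookup xs i)
lookup-member (p ∷ _)  zero    = p
lookup-member (_ ∷ ps) (suc i) = lookup-member ps i

Unique⇒lookup-injective : ∀ {A : Set} {xs : List A} → Unique xs →
  ∀ {i j} → List.lookup xs i ≡ List.lookup xs j → i ≡ j
Unique⇒lookup-injective (_ ∷ _)  {zero}  {zero}  _ = refl
Unique⇒lookup-injective (x∉ ∷ _) {zero}  {suc j} e = ⊥-elim (lookup-member x∉ j e)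
Unique⇒lookup-injective (x∉ ∷ _) {suc i} {zero}  e = ⊥-elim (lookup-member x∉ i (sym e))
Unique⇒lookup-injective (_ ∷ xs) {suc i} {suc j} e = cong suc (Unique⇒lookup-injective xs e)

-- The assignment is a relation because the chosen value may depend on the evidence for `P x`;
-- injectivity concerns related values only, however they were chosen.
length≤-by-injection : ∀ {A : Set} {n} (P : A → Set) (R : A → Fin n → Set) →
  (∀ {x} → P x → ∃ (R x)) →
  (∀ {x y v} → P x → P y → R x v → R y v → x ≡ y) →
  ∀ {xs} → Unique xs → All P xs → length xs ≤ n
length≤-by-injection P R total injective {xs} unique all = injective⇒≤ f-injective
  where
  f : Fin (length xs) → Fin _
  f i = proj₁ (total (lookup-member all i))

  f-injective : ∀ {i j} → f i ≡ f j → i ≡ j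
  f-injective {i} {j} e = Unique⇒lookup-injective unique
    (injective (lookup-member all i) (lookup-member all j)
      (proj₂ (total (lookup-member all i)))
      (subst (R _) (sym e) (proj₂ (total (lookup-member all j)))))

degree : ∀ {m} → List (Subset m) → Fin m → ℕ
degree L v = length (filter (v ∈?_) L)


degree-zero : ∀ {m} (L : List (Subset (suc m))) →
  sum (map ∣_∣ L) ≡ degree L zero + sum (map ∣_∣ (map tail L))
degree-zero [] = refl
degree-zero ((inside ∷ p) ∷ L) = cong suc (trans (cong (∣ p ∣ +_) (degree-zero L)) (x∙yz≈y∙xz ∣ p ∣ (degree L zero) _))
degree-zero ((outside ∷ p) ∷ L) = trans (cong (∣ p ∣ +_) (degree-zero L)) (x∙yz≈y∙xz ∣ p ∣ (degree L zero) _)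

degree-suc : ∀ {m} (L : List (Subset (suc m))) v → degree L (suc v) ≡ degree (map tail L) v
degree-suc [] v = refl
degree-suc ((_ ∷ p) ∷ L) v with v ∈? p
... | yes _ = cong suc (degree-suc L v)
... | no  _ = degree-suc L v

-- Incidences are counted vertex by vertex: `degree-zero` splits off the first vertex, and
-- `degree-suc` carries the other degrees over to the tails.
∑∣S∣≤m*d : ∀ {m d} (L : List (Subset m)) → (∀ v → degree L v ≤ d) → sum (map ∣_∣ L) ≤ m * d
∑∣S∣≤m*d {zero}  [] _ = z≤n
∑∣S∣≤m*d {zero} {d} ([] ∷ L) _ = ∑∣S∣≤m*d {d = d} L (λ ())
∑∣S∣≤m*d {suc m} L h = ≤-trans (≤-reflexive (degree-zero L))
  (+-mono-≤ (h zero) (∑∣S∣≤m*d (map tail L) λ v → ≤-trans (≤-reflexive (sym (degree-suc L v))) (h (suc v))))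

∑-const : ∀ {m d} (L : List (Subset m)) → All (λ S → ∣ S ∣ ≡ d) L → sum (map ∣_∣ L) ≡ length L * d
∑-const [] [] = refl
∑-const (S ∷ L) (e ∷ es) = cong₂ _+_ e (∑-const L es)

size3-others : ∀ {m} (T : Subset m) {x} → ∣ T ∣ ≡ 3 → x ∈ T →
  ∃₂ λ y z → y ∈ T × z ∈ T × x ≢ y × x ≢ z × y ≢ z
size3-others T {x} e x∈T
  with y , y∈T-x ← ∣p∣≡suc⇒Nonempty (T - x) (suc-injective (trans (x∈p⇒1+∣p-x∣≡∣p∣ T x∈T) e))
  with z , z∈T-x-y ← ∣p∣≡suc⇒Nonempty (T - x - y)
         (suc-injective (trans (x∈p⇒1+∣p-x∣≡∣p∣ (T - x) y∈T-x)
           (suc-injective (trans (x∈p⇒1+∣p-x∣≡∣p∣ T x∈T) e))))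
  = y , z , p─q⊆p T _ y∈T-x , p─q⊆p T _ z∈T-x
  , (λ { refl → x∉p-x T x y∈T-x }) , (λ { refl → x∉p-x T x z∈T-x })
  , λ { refl → x∉p-x (T - x) y z∈T-x-y }
  where z∈T-x = p─q⊆p (T - x) _ z∈T-x-y

size3-exhausted : ∀ {m} (T : Subset m) {x y z v} → ∣ T ∣ ≡ 3 → x ∈ T → y ∈ T → z ∈ T →
  x ≢ y → x ≢ z → y ≢ z → v ∈ T → v ≡ x ⊎ v ≡ y ⊎ v ≡ z
size3-exhausted T {x} {y} {z} {v} e x∈T y∈T z∈T x≢y x≢z y≢z v∈T
  with v ≟ x | v ≟ y | v ≟ z
... | yes v≡x | _ | _ = inj₁ v≡x
... | no _ | yes v≡y | _ = inj₂ (inj₁ v≡y)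
... | no _ | no _ | yes v≡z = inj₂ (inj₂ v≡z)
... | no v≢x | no v≢y | no v≢z = ⊥-elim (∣p∣≡0⇒x∉p (T - x - y - z) ∣T-x-y-z∣≡0
        (x∈p∧x≢y⇒x∈p-y (x∈p∧x≢y⇒x∈p-y (x∈p∧x≢y⇒x∈p-y v∈T v≢x) v≢y) v≢z))
  where
  y∈ = x∈p∧x≢y⇒x∈p-y y∈T (≢-sym x≢y)
  z∈ = x∈p∧x≢y⇒x∈p-y (x∈p∧x≢y⇒x∈p-y z∈T (≢-sym x≢z)) (≢-sym y≢z)
  ∣T-x-y-z∣≡0 = suc-injective (trans (x∈p⇒1+∣p-x∣≡∣p∣ (T - x - y) z∈)
                (suc-injective (trans (x∈p⇒1+∣p-x∣≡∣p∣ (T - x) y∈)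
                (suc-injective (trans (x∈p⇒1+∣p-x∣≡∣p∣ T x∈T) e)))))

-- Position relative to a fixed vertex `a`: `a` itself, a neighbour of `a`, or one of two classes
-- into which the other vertices fall.
data Place : Set where
  apex nbr : Place
  side     : Bool → Place

_≟ₚ_ : (k l : Place) → Dec (k ≡ l)
apex   ≟ₚ apex   = yes refl
apex   ≟ₚ nbr    = no λ ()
apex   ≟ₚ side _ = no λ ()
nbr    ≟ₚ apex   = no λ ()
nbr    ≟ₚ nbr    = yes refl
nbr    ≟ₚ side _ = no λ ()
side _ ≟ₚ apex   = no λ ()
side _ ≟ₚ nbr    = no λ ()
side b ≟ₚ side c = map′ (cong side) (λ { refl → refl }) (b Bool.≟ c)

side≢opposite : ∀ b → side b ≢ side (not b)
side≢opposite true  ()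
side≢opposite false ()

abstract
  -- Decided by enumeration; `abstract` keeps the search from unfolding in later proofs.
  avoid-three : ∀ (e f g : Fin 4) → ∃ λ i → i ≢ e × i ≢ f × i ≢ g
  avoid-three = from-yes (all? λ (e : Fin 4) → all? λ (f : Fin 4) → all? λ (g : Fin 4) → any? λ (i : Fin 4) →
    ¬? (i ≟ e) ×-dec (¬? (i ≟ f) ×-dec ¬? (i ≟ g)))

-- Maximal independent triples in a triangle-free graph.

module Triples {m : ℕ} (G : Graph m) (triangleFree : TriangleFree G) where

  infix 4 _~_ _~?_

  _~_ : Fin m → Fin m → Set
  u ~ v = Edge G u v

  _~?_ : ∀ u v → Dec (u ~ v)
  u ~? v = adj G u v Bool.≟ true

  ~-sym : ∀ {u v} → u ~ v → v ~ u
  ~-sym {u} {v} e = trans (adj-sym G v u) e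

  ~-irrefl : ∀ {u} → ¬ u ~ u
  ~-irrefl {u} e with trans (sym e) (irrefl G u)
  ... | ()

  triangle : ∀ {u v w} → u ~ v → v ~ w → w ~ u → ⊥
  triangle uv vw wu = triangleFree _ _ _ uv vw (~-sym wu)

  Stable : (Fin m → Set) → Set
  Stable I = ∀ {u v} → I u → I v → ¬ u ~ v

  Good : Subset m → Set
  Good T = MaximalIndependent G T × ∣ T ∣ ≡ 3

  -- A vertex `v` of `T` missing from `T′` has a neighbour `u` in `T′`. It must lie in `I`, so `u`
  -- does not, so `u` is in `T` as well, against independence. As `I` is not assumed decidable,
  -- membership of `v` is only doubly negated, which is enough for a contradiction.
  determined : ∀ {T T′} (I : Fin m → Set) → Stable I → MaximalIndependent G T → MaximalIndependent G T′ →
    (∀ {v} → ¬ I v → v ∈ T → v ∈ T′) → (∀ {v} → ¬ I v → v ∈ T′ → v ∈ T) → T ≡ T′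
  determined I stable maxT maxT′ T⊆T′ T′⊆T =
    ⊆-antisym (inclusion maxT maxT′ T⊆T′ T′⊆T) (inclusion maxT′ maxT T′⊆T T⊆T′)
    where
    inclusion : ∀ {T T′} → MaximalIndependent G T → MaximalIndependent G T′ →
      (∀ {v} → ¬ I v → v ∈ T → v ∈ T′) → (∀ {v} → ¬ I v → v ∈ T′ → v ∈ T) →
      ∀ {v} → v ∈ T → v ∈ T′
    inclusion {T} {T′} (indep , _) (_ , dom) to from {v} v∈T with v ∈? T′
    ... | yes v∈T′ = v∈T′
    ... | no v∉T′ with dom v v∉T′
    ...   | u , u∈T′ , v~u = ⊥-elim (¬¬Iv λ Iv → indep v u v∈T (from (λ Iu → stable Iv Iu v~u) u∈T′) v~u)
      where
      ¬¬Iv : ¬ ¬ I v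
      ¬¬Iv ¬I = v∉T′ (to ¬I v∈T)

  record Triple (T : Subset m) (x y z : Fin m) : Set where
    field
      maximal : MaximalIndependent G T
      x∈ : x ∈ T
      y∈ : y ∈ T
      z∈ : z ∈ T
      x≢y : x ≢ y
      x≢z : x ≢ z
      y≢z : y ≢ z
      only : ∀ {v} → v ∈ T → v ≡ x ⊎ v ≡ y ⊎ v ≡ z

    x≁y : ¬ x ~ y
    x≁y = proj₁ maximal _ _ x∈ y∈

    x≁z : ¬ x ~ z
    x≁z = proj₁ maximal _ _ x∈ z∈

    y≁z : ¬ y ~ z
    y≁z = proj₁ maximal _ _ y∈ z∈

    outside-T : ∀ {v} → v ≢ x → v ≢ y → v ≢ z → v ∉ T
    outside-T v≢x v≢y v≢z v∈T with only v∈T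
    ... | inj₁ v≡x = v≢x v≡x
    ... | inj₂ (inj₁ v≡y) = v≢y v≡y
    ... | inj₂ (inj₂ v≡z) = v≢z v≡z

    dominated : ∀ {v} → v ∉ T → v ~ x ⊎ v ~ y ⊎ v ~ z
    dominated v∉T with proj₂ maximal _ v∉T
    ... | u , u∈T , v~u with only u∈T
    ...   | inj₁ refl = inj₁ v~u
    ...   | inj₂ (inj₁ refl) = inj₂ (inj₁ v~u)
    ...   | inj₂ (inj₂ refl) = inj₂ (inj₂ v~u)

    via-x : ∀ {v} → v ∉ T → ¬ v ~ y → ¬ v ~ z → v ~ x
    via-x v∉T v≁y v≁z with dominated v∉T
    ... | inj₁ v~x = v~x
    ... | inj₂ (inj₁ v~y) = ⊥-elim (v≁y v~y)
    ... | inj₂ (inj₂ v~z) = ⊥-elim (v≁z v~z)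

    via-y : ∀ {v} → v ∉ T → ¬ v ~ x → ¬ v ~ z → v ~ y
    via-y v∉T v≁x v≁z with dominated v∉T
    ... | inj₁ v~x = ⊥-elim (v≁x v~x)
    ... | inj₂ (inj₁ v~y) = v~y
    ... | inj₂ (inj₂ v~z) = ⊥-elim (v≁z v~z)

    via-z : ∀ {v} → v ∉ T → ¬ v ~ x → ¬ v ~ y → v ~ z
    via-z v∉T v≁x v≁y with dominated v∉T
    ... | inj₁ v~x = ⊥-elim (v≁x v~x)
    ... | inj₂ (inj₁ v~y) = ⊥-elim (v≁y v~y)
    ... | inj₂ (inj₂ v~z) = v~z

  triple : ∀ {T x y z} → Good T → x ∈ T → y ∈ T → z ∈ T → x ≢ y → x ≢ z → y ≢ z → Triple T x y z
  triple {T} (max , size) x∈ y∈ z∈ x≢y x≢z y≢z = record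
    { maximal = max ; x∈ = x∈ ; y∈ = y∈ ; z∈ = z∈ ; x≢y = x≢y ; x≢z = x≢z ; y≢z = y≢z
    ; only = size3-exhausted T size x∈ y∈ z∈ x≢y x≢z y≢z }

  complete : ∀ {T x} → Good T → x ∈ T → ∃₂ λ y z → Triple T x y z
  complete {T} good x∈ with size3-others T (proj₂ good) x∈
  ... | y , z , y∈ , z∈ , x≢y , x≢z , y≢z = y , z , triple good x∈ y∈ z∈ x≢y x≢z y≢z

  swap₂₃ : ∀ {T x y z} → Triple T x y z → Triple T x z y
  swap₂₃ t = record
    { maximal = maximal ; x∈ = x∈ ; y∈ = z∈ ; z∈ = y∈ ; x≢y = x≢z ; x≢z = x≢y ; y≢z = ≢-sym y≢z
    ; only = λ v∈ → reorder (only v∈) }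
    where
    open Triple t
    reorder : ∀ {A B C : Set} → A ⊎ B ⊎ C → A ⊎ C ⊎ B
    reorder (inj₁ a) = inj₁ a
    reorder (inj₂ (inj₁ b)) = inj₂ (inj₂ b)
    reorder (inj₂ (inj₂ c)) = inj₂ (inj₁ c)

  swap₁₂ : ∀ {T x y z} → Triple T x y z → Triple T y x z
  swap₁₂ t = record
    { maximal = maximal ; x∈ = y∈ ; y∈ = x∈ ; z∈ = z∈ ; x≢y = ≢-sym x≢y ; x≢z = y≢z ; y≢z = x≢z
    ; only = λ v∈ → reorder (only v∈) }
    where
    open Triple t
    reorder : ∀ {A B C : Set} → A ⊎ B ⊎ C → B ⊎ A ⊎ C
    reorder (inj₁ a) = inj₂ (inj₁ a)
    reorder (inj₂ (inj₁ b)) = inj₁ b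
    reorder (inj₂ (inj₂ c)) = inj₂ (inj₂ c)

  -- Outside `I` each set is contained in `{y, z}`, which the other set contains, so `determined`
  -- applies.
  agree₁ : ∀ {T T′ x x′ y z} (I : Fin m → Set) → Stable I → Triple T x y z → Triple T′ x′ y z →
           I x → I x′ → T ≡ T′
  agree₁ I stable t t′ Ix Ix′ = determined I stable (Triple.maximal t) (Triple.maximal t′)
    (half t t′ Ix) (half t′ t Ix′)
    where
    half : ∀ {T T′ x x′ y z} → Triple T x y z → Triple T′ x′ y z → I x → ∀ {v} → ¬ I v → v ∈ T → v ∈ T′
    half t t′ Ix ¬Iv v∈T with Triple.only t v∈T
    ... | inj₁ refl = ⊥-elim (¬Iv Ix)
    ... | inj₂ (inj₁ refl) = Triple.y∈ t′
    ... | inj₂ (inj₂ refl) = Triple.z∈ t′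

  agree₂ : ∀ {T T′ x x′ y y′ z} (I : Fin m → Set) → Stable I → Triple T x y z → Triple T′ x′ y′ z →
           I x → I x′ → I y → I y′ → T ≡ T′
  agree₂ I stable t t′ Ix Ix′ Iy Iy′ = determined I stable (Triple.maximal t) (Triple.maximal t′)
    (half t t′ Ix Iy) (half t′ t Ix′ Iy′)
    where
    half : ∀ {T T′ x x′ y y′ z} → Triple T x y z → Triple T′ x′ y′ z → I x → I y →
           ∀ {v} → ¬ I v → v ∈ T → v ∈ T′
    half t t′ Ix Iy ¬Iv v∈T with Triple.only t v∈T
    ... | inj₁ refl = ⊥-elim (¬Iv Ix)
    ... | inj₂ (inj₁ refl) = ⊥-elim (¬Iv Iy)
    ... | inj₂ (inj₂ refl) = Triple.z∈ t′

  -- Transversals of three independent classes.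

  module Transversal {K : Set} (colour : Fin m → K) {i j k : K} (i≢j : i ≢ j) (i≢k : i ≢ k) (j≢k : j ≢ k)
    (stable-i : Stable (λ v → colour v ≡ i)) (stable-j : Stable (λ v → colour v ≡ j))
    (stable-k : Stable (λ v → colour v ≡ k)) where

    record Rainbow (T : Subset m) (p q r : Fin m) : Set where
      constructor rainbow
      field
        tr : Triple T p q r
        pᵢ : colour p ≡ i
        qⱼ : colour q ≡ j
        rₖ : colour r ≡ k
      open Triple tr public

      p∉ : ∀ {v} → colour v ≡ i → v ≢ p → v ∉ T
      p∉ vᵢ v≢p = outside-T v≢p (λ { refl → i≢j (trans (sym vᵢ) qⱼ) }) (λ { refl → i≢k (trans (sym vᵢ) rₖ) })

      q∉ : ∀ {v} → colour v ≡ j → v ≢ q → v ∉ T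
      q∉ vⱼ v≢q = outside-T (λ { refl → i≢j (trans (sym pᵢ) vⱼ) }) v≢q (λ { refl → j≢k (trans (sym vⱼ) rₖ) })

      r∉ : ∀ {v} → colour v ≡ k → v ≢ r → v ∉ T
      r∉ vₖ v≢r = outside-T (λ { refl → i≢k (trans (sym pᵢ) vₖ) }) (λ { refl → j≢k (trans (sym qⱼ) vₖ) }) v≢r

    -- Consequently each member of a family of transversals has a vertex contained in no other member.
    pivot : ∀ {T T₁ T₂ T₃ p q r q₁ r₁ p₂ r₂ p₃ q₃} → Rainbow T p q r →
      Rainbow T₁ p q₁ r₁ → T₁ ≢ T → Rainbow T₂ p₂ q r₂ → T₂ ≢ T → Rainbow T₃ p₃ q₃ r → T₃ ≢ T → ⊥
    pivot {T} {T₁} {T₂} {T₃} {p} {q} {r} {q₁} {r₁} {p₂} {r₂} {p₃} {q₃} t t₁ T₁≢T t₂ T₂≢T t₃ T₃≢T =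
      -- `q₃` lies outside `T₂` but can have no neighbour there: `p₂` would close a triangle through
      -- `r₁`, `r₂` would close one through `p`, and `q` is in the same class as `q₃`.
      cases (T₂.dominated (T₂.q∉ T₃.qⱼ q₃≢q))
      where
      module T  = Rainbow t
      module T₁ = Rainbow t₁
      module T₂ = Rainbow t₂
      module T₃ = Rainbow t₃
      -- Transversals with two common vertices coincide, the third class being independent; hence
      -- each of `T₁`, `T₂`, `T₃` meets `T` in a single vertex.
      q₁≢q : q₁ ≢ q
      q₁≢q refl = T₁≢T (agree₁ _ stable-k (swap₁₂ (swap₂₃ T₁.tr)) (swap₁₂ (swap₂₃ T.tr)) T₁.rₖ T.rₖ)
      r₁≢r : r₁ ≢ r
      r₁≢r refl = T₁≢T (agree₁ _ stable-j (swap₁₂ T₁.tr) (swap₁₂ T.tr) T₁.qⱼ T.qⱼ)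
      p₂≢p : p₂ ≢ p
      p₂≢p refl = T₂≢T (agree₁ _ stable-k (swap₁₂ (swap₂₃ T₂.tr)) (swap₁₂ (swap₂₃ T.tr)) T₂.rₖ T.rₖ)
      r₂≢r : r₂ ≢ r
      r₂≢r refl = T₂≢T (agree₁ _ stable-i T₂.tr T.tr T₂.pᵢ T.pᵢ)
      p₃≢p : p₃ ≢ p
      p₃≢p refl = T₃≢T (agree₁ _ stable-j (swap₁₂ T₃.tr) (swap₁₂ T.tr) T₃.qⱼ T.qⱼ)
      q₃≢q : q₃ ≢ q
      q₃≢q refl = T₃≢T (agree₁ _ stable-i T₃.tr T.tr T₃.pᵢ T.pᵢ)
      q₁~r : q₁ ~ r
      q₁~r = T.via-z (T.q∉ T₁.qⱼ q₁≢q) (λ e → T₁.x≁y (~-sym e)) (stable-j T₁.qⱼ T.qⱼ)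
      r~p₂ : r ~ p₂
      r~p₂ = T₂.via-x (T₂.r∉ T.rₖ (≢-sym r₂≢r)) (λ e → T.y≁z (~-sym e)) (stable-k T.rₖ T₂.rₖ)
      p₂~r₁ : p₂ ~ r₁
      p₂~r₁ = T₁.via-z (T₁.p∉ T₂.pᵢ p₂≢p) (stable-i T₂.pᵢ T.pᵢ) (λ e → triangle e q₁~r r~p₂)
      r₁~q : r₁ ~ q
      r₁~q = T.via-y (T.r∉ T₁.rₖ r₁≢r) (λ e → T₁.x≁z (~-sym e)) (stable-k T₁.rₖ T.rₖ)
      q~p₃ : q ~ p₃
      q~p₃ = T₃.via-x (T₃.q∉ T.qⱼ (≢-sym q₃≢q)) (stable-j T.qⱼ T₃.qⱼ) T.y≁z
      q₃~r₁ : q₃ ~ r₁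
      q₃~r₁ = ~-sym (T₃.via-y (T₃.r∉ T₁.rₖ r₁≢r) (λ e → triangle e (~-sym q~p₃) (~-sym r₁~q)) (stable-k T₁.rₖ T.rₖ))
      p~r₂ : p ~ r₂
      p~r₂ = T₂.via-z (T₂.p∉ T.pᵢ (≢-sym p₂≢p)) (stable-i T.pᵢ T₂.pᵢ) T.x≁y
      p~q₃ : p ~ q₃
      p~q₃ = T₃.via-y (T₃.p∉ T.pᵢ (≢-sym p₃≢p)) (stable-i T.pᵢ T₃.pᵢ) T.x≁z
      cases : q₃ ~ p₂ ⊎ q₃ ~ q ⊎ q₃ ~ r₂ → ⊥
      cases (inj₁ q₃~p₂) = triangle q₃~p₂ p₂~r₁ (~-sym q₃~r₁)
      cases (inj₂ (inj₁ q₃~q)) = stable-j T₃.qⱼ T.qⱼ q₃~q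
      cases (inj₂ (inj₂ q₃~r₂)) = triangle q₃~r₂ (~-sym p~r₂) p~q₃

  -- Non-neighbours of a vertex split into two independent sides.

  module Bipartition
    (a : Fin m) (place : Fin m → Place)
    (place-a : place a ≡ apex)
    (apex⇒≡ : ∀ {v} → place v ≡ apex → v ≡ a)
    (nbr⇒~ : ∀ {v} → place v ≡ nbr → v ~ a)
    (side⇒≁ : ∀ {b v} → place v ≡ side b → ¬ v ~ a)
    (stable-side : ∀ b → Stable (λ v → place v ≡ side b))
    -- `full` carries the strength of the crown: seeing all but two vertices of one side excludes
    -- every neighbour on the other side.
    (full : ∀ b {u x x′} → (∀ {y} → place y ≡ side b → y ≢ x → y ≢ x′ → y ~ u) →
      (∃ λ y → place y ≡ side b × y ~ u) × (∀ {z} → place z ≡ side (not b) → ¬ z ~ u))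
    where

    stable-nbr : Stable (λ v → place v ≡ nbr)
    stable-nbr uₙ vₙ u~v = triangle u~v (nbr⇒~ vₙ) (~-sym (nbr⇒~ uₙ))

    differ : ∀ {u v k l} → place u ≡ k → place v ≡ l → k ≢ l → u ≢ v
    differ uₖ vₗ k≢l refl = k≢l (trans (sym uₖ) vₗ)

    Covers : Bool → Fin m → Fin m → Set
    Covers b u x = ∀ y → place y ≡ side b → y ≢ x → y ~ u

    covers? : ∀ b u x → Dec (Covers b u x)
    covers? b u x = all? λ y → (place y ≟ₚ side b) →-dec (¬? (y ≟ x) →-dec (y ~? u))

    -- Equivalent to maximality of {a, v, w}, for v on side b and w on the opposite side.
    Match : Bool → Fin m → Fin m → Set
    Match b v w = Covers (not b) v w × Covers b w v

    match? : ∀ b v w → Dec (Match b v w)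
    match? b v w = covers? (not b) v w ×-dec covers? b w v

    Meets : Place → Subset m → Set
    Meets l T = ∃ λ v → v ∈ T × place v ≡ l

    meets? : ∀ l T → Dec (Meets l T)
    meets? l T = any? λ v → (v ∈? T) ×-dec (place v ≟ₚ l)

    Mixed : Subset m → Set
    Mixed T = Meets nbr T × ∀ b → Meets (side b) T

    mixed? : ∀ T → Dec (Mixed T)
    mixed? T = meets? nbr T ×-dec map′ (λ { (f , t) false → f ; (f , t) true → t }) (λ h → h false , h true)
                 (meets? (side false) T ×-dec meets? (side true) T)

    record MixedTriple (b : Bool) (T : Subset m) (u v w : Fin m) : Set where
      constructor mixed
      field
        tr : Triple T u v w
        uₙ : place u ≡ nbr
        vₛ : place v ≡ side b
        wₛ : place w ≡ side (not b)
      open Triple tr public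

      u∉ : ∀ {x} → place x ≡ nbr → x ≢ u → x ∉ T
      u∉ xₙ x≢u = outside-T x≢u (differ xₙ vₛ λ ()) (differ xₙ wₛ λ ())

      v∉ : ∀ {x} → place x ≡ side b → x ≢ v → x ∉ T
      v∉ xₛ x≢v = outside-T (differ xₛ uₙ λ ()) x≢v (differ xₛ wₛ (side≢opposite b))

      w∉ : ∀ {x} → place x ≡ side (not b) → x ≢ w → x ∉ T
      w∉ xₛ x≢w = outside-T (differ xₛ uₙ λ ()) (differ xₛ vₛ (≢-sym (side≢opposite b))) x≢w

      isMixed : Mixed T
      isMixed = (u , x∈ , uₙ) , onSide b vₛ wₛ
        where
        onSide : ∀ b → place v ≡ side b → place w ≡ side (not b) → ∀ c → Meets (side c) T
        onSide true  v₁ w₀ true  = v , y∈ , v₁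
        onSide true  v₁ w₀ false = w , z∈ , w₀
        onSide false v₀ w₁ true  = w , z∈ , w₁
        onSide false v₀ w₁ false = v , y∈ , v₀

    opposite : ∀ {b T u v w} → MixedTriple b T u v w → MixedTriple (not b) T u w v
    opposite {true}  (mixed t u v w) = mixed (swap₂₃ t) u w v
    opposite {false} (mixed t u v w) = mixed (swap₂₃ t) u w v

    mixed-nbr : ∀ {T u} → Good T → Mixed T → u ∈ T → place u ≡ nbr → ∃₂ (MixedTriple true T u)
    mixed-nbr good (_ , s) u∈ uₙ with s true | s false
    ... | v , v∈ , v₁ | w , w∈ , w₀ =
      v , w , mixed (triple good u∈ v∈ w∈ (differ uₙ v₁ λ ()) (differ uₙ w₀ λ ()) (differ v₁ w₀ λ ())) uₙ v₁ w₀

    mixed-side : ∀ {b T v} → Good T → Mixed T → v ∈ T → place v ≡ side b → ∃₂ λ u w → MixedTriple b T u v w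
    mixed-side {b} good ((u , u∈ , uₙ) , s) v∈ vₛ with s (not b)
    ... | w , w∈ , wₛ =
      u , w , mixed (triple good u∈ v∈ w∈ (differ uₙ vₛ λ ()) (differ uₙ wₛ λ ()) (differ vₛ wₛ (side≢opposite b))) uₙ vₛ wₛ

    module Transverse = Transversal place {nbr} {side true} {side false} (λ ()) (λ ()) (λ ())
      stable-nbr (stable-side true) (stable-side false)

    hub : Bool → Place
    hub true  = apex
    hub false = nbr

    stable-hub : ∀ b → Stable (λ v → place v ≡ hub b)
    stable-hub true  u v u~v rewrite apex⇒≡ u | apex⇒≡ v = ~-irrefl u~v
    stable-hub false = stable-nbr

    -- An injective charging of the sets to the vertices.

    module Charging (F : List (Subset m)) (allGood : All Good F) where

      Rival : Subset m → Fin m → Subset m → Set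
      Rival T v T′ = Mixed T′ × v ∈ T′ × T′ ≢ T

      rival? : ∀ T v → Dec (Any (Rival T v) F)
      rival? T v = Any.any? (λ T′ → mixed? T′ ×-dec ((v ∈? T′) ×-dec ¬? (≡-dec Bool._≟_ T′ T))) F

      Private : Fin m → Subset m → Set
      Private v T = ¬ Any (Rival T v) F

      private-unique : ∀ {v T T′} → Private v T → T′ ∈ₗ F → Mixed T′ → v ∈ T′ → T ≡ T′
      private-unique {v} {T} {T′} p T′∈F mix v∈ with ≡-dec Bool._≟_ T′ T
      ... | yes e  = sym e
      ... | no  ne = ⊥-elim (p (lose T′∈F (mix , v∈ , ne)))

      -- A set is charged to a vertex v it contains (sets inside N(a) are charged to a).  When {a, x, y}
      -- is itself maximal (Match), it is charged to x on side true, and its at most one companion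
      -- {u, x, y} with u ∈ N(a) to y on side false; this is what hub records.
      data SideCharge (b : Bool) (T : Subset m) (v : Fin m) : Set where
        matched : ∀ {h w} → Triple T h v w → place h ≡ hub b → place w ≡ side (not b) →
                  Match b v w → SideCharge b T v
        alone   : ∀ {u w} → MixedTriple b T u v w → ¬ Match b v w → Private v T → SideCharge b T v
        missed  : ∀ {u u′} → Triple T u u′ v → place u ≡ nbr → place u′ ≡ nbr →
                  ¬ Covers b u v → ¬ Covers b u′ v → SideCharge b T v

      -- In the first two cases `v` sees almost all of one side, hence by `full` nothing of the
      -- other; in the last it sees both sides. This keeps `alone` apart from the others.
      data NbrCharge (T : Subset m) (v : Fin m) : Set where
        sameSide : ∀ {b x x′} → Triple T v x x′ → place x ≡ side b → place x′ ≡ side b → NbrCharge T v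
        covering : ∀ {b u x} → Triple T v u x → place u ≡ nbr → place x ≡ side b → Covers b v x → NbrCharge T v
        alone    : v ∈ T → Mixed T → Private v T → (∀ b → ∃ λ y → place y ≡ side b × y ~ v) → NbrCharge T v

      ChargeAt : Place → Subset m → Fin m → Set
      ChargeAt apex     T v = ∀ {t} → t ∈ T → place t ≡ nbr
      ChargeAt nbr      T v = NbrCharge T v
      ChargeAt (side b) T v = SideCharge b T v

      Charge : Subset m → Fin m → Set
      Charge T v = ChargeAt (place v) T v

      -- The match joins `v` to its whole opposite side except `w`, whereas `v` and `w′` share an
      -- independent set.
      unmatched : ∀ {b T u v w w′} → Triple T u v w′ → place w′ ≡ side (not b) → Match b v w → w′ ≡ w
      unmatched {w = w} {w′} t w′ₛ (c , _) with w′ ≟ w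
      ... | yes e = e
      ... | no ne = ⊥-elim (Triple.y≁z t (~-sym (c w′ w′ₛ ne)))

      missed∉ : ∀ {b T u u′ v y} → Triple T u u′ v → place u ≡ nbr → place u′ ≡ nbr → place v ≡ side b →
                place y ≡ side b → y ≢ v → y ∉ T
      missed∉ t uₙ u′ₙ vₛ yₛ y≢v = Triple.outside-T t (differ yₛ uₙ λ ()) (differ yₛ u′ₙ λ ()) y≢v

      -- Each further `y` on the side of `v` is adjacent to `w`, so it cannot be adjacent to `u`,
      -- and only `u′` is left to dominate it.
      matched-missed : ∀ {b T u u′ v w} → Triple T u u′ v → place u ≡ nbr → place u′ ≡ nbr → place v ≡ side b →
        Match b v w → w ~ u → Covers b u′ v
      matched-missed {b} t uₙ u′ₙ vₛ (_ , c) w~u y yₛ y≢v =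
        Triple.via-y t (missed∉ t uₙ u′ₙ vₛ yₛ y≢v) (λ y~u → triangle (c y yₛ y≢v) w~u (~-sym y~u))
          (stable-side b yₛ vₛ)

      -- In `T` only `w` can dominate `u′`. A vertex `y` dominated by `w` is therefore not adjacent
      -- to `u′`, and `T′` leaves only `u` to dominate it.
      mixed-missed : ∀ {b T T′ u u′ v w} → MixedTriple b T u v w → Triple T′ u u′ v → place u′ ≡ nbr → Covers b u v
      mixed-missed {b} {T} {T′} {u} {u′} {v} {w} mt t u′ₙ y yₛ y≢v with dominated (v∉ yₛ y≢v)
        where open MixedTriple mt
      ... | inj₁ y~u = y~u
      ... | inj₂ (inj₁ y~v) = ⊥-elim (stable-side b yₛ (MixedTriple.vₛ mt) y~v)
      ... | inj₂ (inj₂ y~w) = Triple.via-x t (missed∉ t uₙ u′ₙ vₛ yₛ y≢v)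
              (λ y~u′ → triangle y~u′ u′~w (~-sym y~w)) (stable-side b yₛ vₛ)
        where
        open MixedTriple mt
        u′~w : u′ ~ w
        u′~w = via-z (u∉ u′ₙ (≢-sym (Triple.x≢y t))) (stable-nbr u′ₙ uₙ) (Triple.y≁z t)

      matched≠missed : ∀ {b T T′ v h w u u′} {X : Set} → place v ≡ side b →
        Triple T h v w → place w ≡ side (not b) → Match b v w →
        Triple T′ u u′ v → place u ≡ nbr → place u′ ≡ nbr → ¬ Covers b u v → ¬ Covers b u′ v → X
      matched≠missed {b} vₛ t wₛ mt t′ uₙ u′ₙ nu nu′
        with Triple.dominated t′ (Triple.outside-T t′ (differ wₛ uₙ λ ()) (differ wₛ u′ₙ λ ())
               (differ wₛ vₛ (≢-sym (side≢opposite b))))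
      ... | inj₁ w~u = ⊥-elim (nu′ (matched-missed t′ uₙ u′ₙ vₛ mt w~u))
      ... | inj₂ (inj₁ w~u′) = ⊥-elim (nu (matched-missed (swap₁₂ t′) u′ₙ uₙ vₛ mt w~u′))
      ... | inj₂ (inj₂ w~v) = ⊥-elim (Triple.y≁z t (~-sym w~v))

      -- `u₁` is adjacent neither to `v` nor to anything in N(a), so maximality of `T′` puts it in
      -- `T′`; it is then `u` or `u′`, and `mixed-missed` makes that vertex cover the side.
      alone≠missed : ∀ {b T T′ v u₁ w u u′} {X : Set} → MixedTriple b T u₁ v w →
        Triple T′ u u′ v → place u ≡ nbr → place u′ ≡ nbr → ¬ Covers b u v → ¬ Covers b u′ v → X
      alone≠missed {b} {T} {T′} {v} {u₁} mt t′ uₙ u′ₙ nu nu′ with u₁ ∈? T′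
      ... | no u₁∉ with Triple.dominated t′ u₁∉
      ...   | inj₁ e = ⊥-elim (stable-nbr (MixedTriple.uₙ mt) uₙ e)
      ...   | inj₂ (inj₁ e) = ⊥-elim (stable-nbr (MixedTriple.uₙ mt) u′ₙ e)
      ...   | inj₂ (inj₂ e) = ⊥-elim (MixedTriple.x≁y mt e)
      alone≠missed {b} {T} {T′} {v} {u₁} mt t′ uₙ u′ₙ nu nu′ | yes u₁∈ with Triple.only t′ u₁∈
      ...   | inj₁ refl = ⊥-elim (nu (mixed-missed mt t′ u′ₙ))
      ...   | inj₂ (inj₁ refl) = ⊥-elim (nu′ (mixed-missed mt (swap₁₂ t′) uₙ))
      ...   | inj₂ (inj₂ refl) = ⊥-elim (MixedTriple.x≢y mt refl)

      -- Two matched sets share `v` and its partner, and their third vertices lie in the independent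
      -- class `hub b`. A matched set forces the same partner on an `alone` set, against its failed
      -- match. Two `missed` sets differ only inside N(a).
      side-injective : ∀ {b T T′ v} → T ∈ₗ F → T′ ∈ₗ F → place v ≡ side b →
        SideCharge b T v → SideCharge b T′ v → T ≡ T′
      side-injective {b} _ _ vₛ (matched t hₕ wₛ mt) (matched t′ h′ₕ w′ₛ mt′)
        with refl ← unmatched t′ w′ₛ mt = agree₁ _ (stable-hub b) t t′ hₕ h′ₕ
      side-injective _ _ vₛ (matched t hₕ wₛ mt) (alone t′ nm p)
        with refl ← unmatched (MixedTriple.tr t′) (MixedTriple.wₛ t′) mt = ⊥-elim (nm mt)
      side-injective _ _ vₛ (alone t nm p) (matched t′ h′ₕ w′ₛ mt′)
        with refl ← unmatched (MixedTriple.tr t) (MixedTriple.wₛ t) mt′ = ⊥-elim (nm mt′)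
      side-injective _ _ vₛ (matched t hₕ wₛ mt) (missed t′ uₙ u′ₙ nu nu′) =
        matched≠missed vₛ t wₛ mt t′ uₙ u′ₙ nu nu′
      side-injective _ _ vₛ (missed t uₙ u′ₙ nu nu′) (matched t′ hₕ wₛ mt) =
        matched≠missed vₛ t′ wₛ mt t uₙ u′ₙ nu nu′
      side-injective _ T′∈F vₛ (alone t _ p) (alone t′ _ _) =
        private-unique p T′∈F (MixedTriple.isMixed t′) (MixedTriple.y∈ t′)
      side-injective _ _ vₛ (alone t _ _) (missed t′ uₙ u′ₙ nu nu′) = alone≠missed t t′ uₙ u′ₙ nu nu′
      side-injective _ _ vₛ (missed t uₙ u′ₙ nu nu′) (alone t′ _ _) = alone≠missed t′ t uₙ u′ₙ nu nu′
      side-injective _ _ vₛ (missed t uₙ u′ₙ _ _) (missed t′ wₙ w′ₙ _ _) =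
        agree₂ _ stable-nbr t t′ uₙ wₙ u′ₙ w′ₙ

      Directed : Bool → Fin m → Set
      Directed b v = (∃ λ y → place y ≡ side b × y ~ v) × (∀ {z} → place z ≡ side (not b) → ¬ z ~ v)

      directed-unique : ∀ {b c v} → Directed b v → Directed c v → b ≡ c
      directed-unique {true}  {true}  _ _ = refl
      directed-unique {false} {false} _ _ = refl
      directed-unique {true}  {false} ((y , yₛ , y~v) , _) (_ , none) = ⊥-elim (none yₛ y~v)
      directed-unique {false} {true}  ((y , yₛ , y~v) , _) (_ , none) = ⊥-elim (none yₛ y~v)

      undirected : ∀ {b v} → Directed b v → (∀ c → ∃ λ y → place y ≡ side c × y ~ v) → ⊥
      undirected {b} (_ , none) h with h (not b)
      ... | y , yₛ , y~v = none yₛ y~v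

      sameSide-directed : ∀ {b T v x x′} → place v ≡ nbr → Triple T v x x′ → place x ≡ side b → place x′ ≡ side b →
        Directed b v
      sameSide-directed {b} vₙ t xₛ x′ₛ = full b λ yₛ y≢x y≢x′ →
        Triple.via-x t (Triple.outside-T t (differ yₛ vₙ λ ()) y≢x y≢x′) (stable-side b yₛ xₛ) (stable-side b yₛ x′ₛ)

      covers-directed : ∀ {b v x} → Covers b v x → Directed b v
      covers-directed {b} {x = x} c = full b {x = x} {x′ = x} λ yₛ y≢x _ → c _ yₛ y≢x

      uncovered : ∀ {b v x y} → place y ≡ side b → ¬ v ~ y → Covers b v x → y ≡ x
      uncovered {x = x} {y} yₛ v≁y c with y ≟ x
      ... | yes e = e
      ... | no ne = ⊥-elim (v≁y (~-sym (c y yₛ ne)))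

      -- `v` misses both `x` and `x′`, but covering a side allows a single exception.
      sameSide≠covering : ∀ {b T v x x′ z} {X : Set} → Triple T v x x′ → place x ≡ side b → place x′ ≡ side b →
        Covers b v z → X
      sameSide≠covering t xₛ x′ₛ c =
        ⊥-elim (Triple.y≢z t (trans (uncovered xₛ (Triple.x≁y t) c) (sym (uncovered x′ₛ (Triple.x≁z t) c))))

      last-first : ∀ {T x y z} → Triple T x y z → Triple T y z x
      last-first t = swap₂₃ (swap₁₂ t)

      -- The vertex `v` determines the side it is directed to. Two `sameSide` sets then differ only
      -- on that independent side; two `covering` sets share the exception and differ only inside
      -- N(a).
      nbr-injective : ∀ {T T′ v} → T ∈ₗ F → T′ ∈ₗ F → place v ≡ nbr → NbrCharge T v → NbrCharge T′ v → T ≡ T′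
      nbr-injective _ _ vₙ (sameSide {b} t xₛ x′ₛ) (sameSide t′ zₛ z′ₛ)
        with refl ← directed-unique (sameSide-directed vₙ t xₛ x′ₛ) (sameSide-directed vₙ t′ zₛ z′ₛ) =
        agree₂ _ (stable-side b) (last-first t) (last-first t′) xₛ zₛ x′ₛ z′ₛ
      nbr-injective _ _ vₙ (sameSide t xₛ x′ₛ) (covering t′ uₙ zₛ c)
        with refl ← directed-unique (sameSide-directed vₙ t xₛ x′ₛ) (covers-directed c) = sameSide≠covering t xₛ x′ₛ c
      nbr-injective _ _ vₙ (covering t uₙ zₛ c) (sameSide t′ xₛ x′ₛ)
        with refl ← directed-unique (sameSide-directed vₙ t′ xₛ x′ₛ) (covers-directed c) = sameSide≠covering t′ xₛ x′ₛ c
      nbr-injective _ _ vₙ (covering t uₙ xₛ c) (covering t′ u′ₙ x′ₛ c′)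
        with refl ← directed-unique (covers-directed c) (covers-directed c′)
        with refl ← uncovered x′ₛ (Triple.x≁z t′) c = agree₂ _ stable-nbr t t′ vₙ vₙ uₙ u′ₙ
      nbr-injective _ _ vₙ (sameSide t xₛ x′ₛ) (alone _ _ _ h) = ⊥-elim (undirected (sameSide-directed vₙ t xₛ x′ₛ) h)
      nbr-injective _ _ vₙ (alone _ _ _ h) (sameSide t xₛ x′ₛ) = ⊥-elim (undirected (sameSide-directed vₙ t xₛ x′ₛ) h)
      nbr-injective _ _ vₙ (covering _ _ _ c) (alone _ _ _ h) = ⊥-elim (undirected (covers-directed c) h)
      nbr-injective _ _ vₙ (alone _ _ _ h) (covering _ _ _ c) = ⊥-elim (undirected (covers-directed c) h)
      nbr-injective _ T′∈F vₙ (alone _ _ p _) (alone v∈ mix _ _) = private-unique p T′∈F mix v∈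

      charge-injective : ∀ {T T′ v} → T ∈ₗ F → T′ ∈ₗ F → Charge T v → Charge T′ v → T ≡ T′
      charge-injective {T} {T′} {v} T∈F T′∈F = at (place v) refl
        where
        at : ∀ l → place v ≡ l → ChargeAt l T v → ChargeAt l T′ v → T ≡ T′
        -- Both sets lie inside N(a), so their parts outside it are empty and agree.
        at apex _ c c′ = determined (λ u → place u ≡ nbr) stable-nbr
          (proj₁ (All.lookup allGood T∈F)) (proj₁ (All.lookup allGood T′∈F))
          (λ ¬n t∈ → ⊥-elim (¬n (c t∈))) (λ ¬n t∈ → ⊥-elim (¬n (c′ t∈)))
        at nbr vₙ = nbr-injective T∈F T′∈F vₙ
        at (side b) vₛ = side-injective T∈F T′∈F vₛ

      chargeAt : ∀ {T v l} → place v ≡ l → ChargeAt l T v → ∃ (Charge T)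
      chargeAt {T} {v} e c = v , subst (λ l → ChargeAt l T v) (sym e) c

      rival : ∀ {T v} → Any (Rival T v) F → ∃ λ T′ → Good T′ × Rival T v T′
      rival any with find any
      ... | T′ , T′∈F , r = T′ , All.lookup allGood T′∈F , r

      toRainbow : ∀ {T u v w} → MixedTriple true T u v w → Transverse.Rainbow T u v w
      toRainbow (mixed t u v w) = Transverse.rainbow t u v w

      -- If u has no neighbour on the side of w, then v is adjacent to that whole side except w.
      private-side : ∀ {b T u v w} → MixedTriple b T u v w → (∀ {z} → place z ≡ side (not b) → ¬ z ~ u) → Private v T
      private-side {b} {T} {u} {v} {w} mt none any
        with T′ , good′ , mix′ , v∈′ , T′≢T ← rival any
        with _ , w′ , mt′ ← mixed-side good′ mix′ v∈′ (MixedTriple.vₛ mt) = T′≢T (same w′ mt′)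
        where
        open MixedTriple mt
        same : ∀ {u′} w′ → MixedTriple b T′ u′ v w′ → T′ ≡ T
        same w′ mt′ with w′ ≟ w
        ... | yes refl = agree₁ _ stable-nbr (MixedTriple.tr mt′) tr (MixedTriple.uₙ mt′) uₙ
        ... | no w′≢w = ⊥-elim (MixedTriple.y≁z mt′ (~-sym
                (via-y (w∉ (MixedTriple.wₛ mt′) w′≢w) (none (MixedTriple.wₛ mt′))
                  (stable-side (not b) (MixedTriple.wₛ mt′) wₛ))))

      neighbour? : ∀ b u → Dec (∃ λ y → place y ≡ side b × y ~ u)
      neighbour? b u = any? λ y → (place y ≟ₚ side b) ×-dec (y ~? u)

      -- If `u` sees nothing on one side, the vertex of `T` on the other side is private. Otherwise
      -- `u` sees both sides, as its own charge requires, and `pivot` makes one of `u`, `v`, `w`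
      -- private.
      charge-unmatched : ∀ {T u v w} → MixedTriple true T u v w → ¬ Match true v w → ∃ (Charge T)
      charge-unmatched {T} {u} {v} {w} mt nm with neighbour? false u | neighbour? true u
      ... | no none | _ = chargeAt (MixedTriple.vₛ mt)
              (alone mt nm (private-side mt λ zₛ z~u → none (_ , zₛ , z~u)))
      ... | yes _ | no none = chargeAt (MixedTriple.wₛ mt)
              (alone (opposite mt) (λ { (c , d) → nm (d , c) })
                (private-side (opposite mt) λ zₛ z~u → none (_ , zₛ , z~u)))
      ... | yes f | yes t with rival? T u | rival? T v | rival? T w
      ...   | no p | _ | _ = chargeAt (MixedTriple.uₙ mt)
                (alone (MixedTriple.x∈ mt) (MixedTriple.isMixed mt) p λ { false → f ; true → t })
      ...   | yes _ | no p | _ = chargeAt (MixedTriple.vₛ mt) (alone mt nm p)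
      ...   | yes _ | yes _ | no p = chargeAt (MixedTriple.wₛ mt) (alone (opposite mt) (λ { (c , d) → nm (d , c) }) p)
      ...   | yes r₁ | yes r₂ | yes r₃
              with _ , g₁ , m₁ , ∈₁ , ne₁ ← rival r₁
              with _ , g₂ , m₂ , ∈₂ , ne₂ ← rival r₂
              with _ , g₃ , m₃ , ∈₃ , ne₃ ← rival r₃
              with _ , _ , t₁ ← mixed-nbr g₁ m₁ ∈₁ (MixedTriple.uₙ mt)
              with _ , _ , t₂ ← mixed-side g₂ m₂ ∈₂ (MixedTriple.vₛ mt)
              with _ , _ , t₃ ← mixed-side g₃ m₃ ∈₃ (MixedTriple.wₛ mt)
              = ⊥-elim (Transverse.pivot (toRainbow mt) (toRainbow t₁) ne₁ (toRainbow t₂) ne₂ (toRainbow (opposite t₃)) ne₃)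

      charge-mixed : ∀ {T u v w} → MixedTriple true T u v w → ∃ (Charge T)
      charge-mixed {v = v} {w} mt with match? true v w
      ... | no nm = charge-unmatched mt nm
      ... | yes (c , d) = chargeAt wₛ (matched (swap₂₃ tr) uₙ vₛ (d , c))
        where open MixedTriple mt

      charge-pair : ∀ {b T u u′ x} → Triple T u u′ x → place u ≡ nbr → place u′ ≡ nbr → place x ≡ side b → ∃ (Charge T)
      charge-pair {b} {u = u} {u′} {x} t uₙ u′ₙ xₛ with covers? b u x | covers? b u′ x
      ... | yes c | _     = chargeAt uₙ (covering t u′ₙ xₛ c)
      ... | no _  | yes c = chargeAt u′ₙ (covering (swap₁₂ t) uₙ xₛ c)
      ... | no n  | no n′ = chargeAt xₛ (missed t uₙ u′ₙ n n′)

      charge-nbr : ∀ {T u x y} → Triple T u x y → place u ≡ nbr → place x ≢ apex → place y ≢ apex → ∃ (Charge T)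
      charge-nbr {T} {u} {x} {y} t uₙ x≢ y≢ = go (place x) (place y) refl refl
        where
        go : ∀ k l → place x ≡ k → place y ≡ l → ∃ (Charge T)
        go apex _ xₖ yₗ = ⊥-elim (x≢ xₖ)
        go _ apex xₖ yₗ = ⊥-elim (y≢ yₗ)
        go nbr nbr xₖ yₗ = chargeAt place-a all-nbr
          where
          all-nbr : ∀ {v} → v ∈ T → place v ≡ nbr
          all-nbr v∈ with Triple.only t v∈
          ... | inj₁ refl = uₙ
          ... | inj₂ (inj₁ refl) = xₖ
          ... | inj₂ (inj₂ refl) = yₗ
        go nbr (side _) xₖ yₗ = charge-pair t uₙ xₖ yₗ
        go (side _) nbr xₖ yₗ = charge-pair (swap₂₃ t) uₙ yₗ xₖ
        go (side true)  (side true)  xₖ yₗ = chargeAt uₙ (sameSide t xₖ yₗ)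
        go (side false) (side false) xₖ yₗ = chargeAt uₙ (sameSide t xₖ yₗ)
        go (side true)  (side false) xₖ yₗ = charge-mixed (mixed t uₙ xₖ yₗ)
        go (side false) (side true)  xₖ yₗ = charge-mixed (mixed (swap₂₃ t) uₙ yₗ xₖ)

      -- Only `a` could dominate the rest of that side, so `full` would give `a` a neighbour there.
      same-side-apex : ∀ {b T x y} {X : Set} → Triple T a x y → place x ≡ side b → place y ≡ side b → X
      same-side-apex {b} t xₛ yₛ
        with full b (λ zₛ z≢x z≢y → Triple.via-x t (Triple.outside-T t (differ zₛ place-a λ ()) z≢x z≢y)
               (stable-side b zₛ xₛ) (stable-side b zₛ yₛ))
      ... | (z , zₛ , z~a) , _ = ⊥-elim (side⇒≁ zₛ z~a)

      charge-apex-pair : ∀ {T x y} → Triple T a x y → place x ≡ side true → place y ≡ side false → ∃ (Charge T)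
      charge-apex-pair t x₁ y₀ = chargeAt x₁ (matched t place-a y₀
        ( (λ z zₛ z≢y → via-y (outside-T (differ zₛ place-a λ ()) (differ zₛ x₁ λ ()) z≢y) (side⇒≁ zₛ) (stable-side false zₛ y₀))
        , (λ z zₛ z≢x → via-z (outside-T (differ zₛ place-a λ ()) z≢x (differ zₛ y₀ λ ())) (side⇒≁ zₛ) (stable-side true zₛ x₁)) ))
        where open Triple t

      charge-apex : ∀ {T x y} → Triple T a x y → ∃ (Charge T)
      charge-apex {T} {x} {y} t = go (place x) (place y) refl refl
        where
        open Triple t
        go : ∀ k l → place x ≡ k → place y ≡ l → ∃ (Charge T)
        go apex _ xₖ yₗ = ⊥-elim (x≢y (sym (apex⇒≡ xₖ)))
        go nbr  _ xₖ yₗ = ⊥-elim (x≁y (~-sym (nbr⇒~ xₖ)))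
        go (side _) apex xₖ yₗ = ⊥-elim (x≢z (sym (apex⇒≡ yₗ)))
        go (side _) nbr  xₖ yₗ = ⊥-elim (x≁z (~-sym (nbr⇒~ yₗ)))
        go (side true)  (side true)  xₖ yₗ = same-side-apex t xₖ yₗ
        go (side false) (side false) xₖ yₗ = same-side-apex t xₖ yₗ
        go (side true)  (side false) xₖ yₗ = charge-apex-pair t xₖ yₗ
        go (side false) (side true)  xₖ yₗ = charge-apex-pair (swap₂₃ t) yₗ xₖ

      charge : ∀ {T} → Good T → ∃ (Charge T)
      charge {T} good with a ∈? T
      ... | yes a∈ with complete good a∈
      ...   | _ , _ , t = charge-apex t
      charge {T} good | no a∉ with proj₂ (proj₁ good) a a∉
      ... | u , u∈ , a~u with complete good u∈
      ...   | x , y , t = charge-nbr t (isNbr (place u) refl) (notApex (Triple.y∈ t)) (notApex (Triple.z∈ t))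
        where
        notApex : ∀ {v} → v ∈ T → place v ≢ apex
        notApex v∈ vₐ rewrite apex⇒≡ vₐ = a∉ v∈
        isNbr : ∀ l → place u ≡ l → place u ≡ nbr
        isNbr apex     uₗ = ⊥-elim (notApex u∈ uₗ)
        isNbr nbr      uₗ = uₗ
        isNbr (side _) uₗ = ⊥-elim (side⇒≁ uₗ (~-sym a~u))

      size≤m : Unique F → length F ≤ m
      size≤m unique = length≤-by-injection (_∈ₗ F) Charge (λ T∈F → charge (All.lookup allGood T∈F))
        charge-injective unique (All.tabulate λ T∈F → T∈F)

  -- The crown formed by four sets that pairwise meet only in one vertex.

  module Crown
    (a : Fin m) (S : Fin 4 → Subset m) (good : ∀ i → Good (S i)) (a∈ : ∀ i → a ∈ S i)
    (disjoint : ∀ {i j v} → i ≢ j → v ∈ S i → v ∈ S j → v ≡ a)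
    where

    y₀ z₀ : Fin m
    y₀ = proj₁ (complete (good zero) (a∈ zero))
    z₀ = proj₁ (proj₂ (complete (good zero) (a∈ zero)))

    t₀ : Triple (S zero) a y₀ z₀
    t₀ = proj₂ (proj₂ (complete (good zero) (a∈ zero)))

    -- `y₀` is outside every other `S i` and not adjacent to `a`, so it sees one of the two
    -- remaining vertices; that one is named `z`.
    orient : ∀ i → ∃₂ λ y z → Triple (S i) a y z × (i ≢ zero → y₀ ~ z)
    orient zero = y₀ , z₀ , t₀ , λ 0≢0 → ⊥-elim (0≢0 refl)
    orient (suc i) with complete (good (suc i)) (a∈ (suc i))
    ... | y , z , t with Triple.dominated t (λ y₀∈ → Triple.x≢y t₀ (sym (disjoint {zero} {suc i} (λ ()) (Triple.y∈ t₀) y₀∈)))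
    ...   | inj₁ y₀~a = ⊥-elim (Triple.x≁y t₀ (~-sym y₀~a))
    ...   | inj₂ (inj₁ y₀~y) = z , y , swap₂₃ t , λ _ → y₀~y
    ...   | inj₂ (inj₂ y₀~z) = y , z , t , λ _ → y₀~z

    end : Bool → Fin 4 → Fin m
    end true  i = proj₁ (orient i)
    end false i = proj₁ (proj₂ (orient i))

    ends : ∀ b i → Triple (S i) a (end b i) (end (not b) i)
    ends true  i = proj₁ (proj₂ (proj₂ (orient i)))
    ends false i = swap₂₃ (ends true i)

    end≢a : ∀ b i → end b i ≢ a
    end≢a b i = ≢-sym (Triple.x≢y (ends b i))

    end∉ : ∀ b {i j} → i ≢ j → end b i ∉ S j
    end∉ b {i} i≢j e∈ = end≢a b i (disjoint i≢j (Triple.y∈ (ends b i)) e∈)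

    end≁a : ∀ b i → ¬ end b i ~ a
    end≁a b i e~a = Triple.x≁y (ends b i) (~-sym e~a)

    end-injective : ∀ b {i j} → end b i ≡ end b j → i ≡ j
    end-injective b {i} {j} e with i ≟ j
    ... | yes i≡j = i≡j
    ... | no i≢j = ⊥-elim (end∉ b i≢j (subst (_∈ S j) (sym e) (Triple.y∈ (ends b j))))

    crown₀ : ∀ {j} → j ≢ zero → y₀ ~ end false j
    crown₀ {j} = proj₂ (proj₂ (proj₂ (orient j)))

    crown₊ : ∀ {i j} → i ≢ zero → j ≢ zero → i ≢ j → end true i ~ end false j
    crown₊ {i} {j} i≢0 j≢0 i≢j = ~-sym (Triple.via-y (ends true i) (end∉ false (≢-sym i≢j)) (end≁a false j)
      λ zz → triangle zz (~-sym (crown₀ i≢0)) (crown₀ j≢0))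

    crown-true : ∀ i j → i ≢ j → end true i ~ end false j
    crown-true i j i≢j with i ≟ zero | j ≟ zero
    ... | yes refl | yes refl = ⊥-elim (i≢j refl)
    ... | yes refl | no j≢0 = crown₀ j≢0
    ... | no i≢0 | no j≢0 = crown₊ i≢0 j≢0 i≢j
    ... | no i≢0 | yes refl with avoid-three zero i i
    -- A third index `l` rules out an edge to `y₀`, since `end false l` is adjacent to both
    -- vertices.
    ...   | l , l≢0 , l≢i , _ = Triple.via-z t₀ (end∉ true i≢0) (end≁a true i)
              λ yy → triangle yy (crown₀ l≢0) (~-sym (crown₊ i≢0 l≢0 (≢-sym l≢i)))

    crown : ∀ b {i j} → i ≢ j → end b i ~ end (not b) j
    crown true  i≢j = crown-true _ _ i≢j
    crown false i≢j = ~-sym (crown-true _ _ (≢-sym i≢j))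

    index : ∀ b v → ∃ λ e → ∀ i → i ≢ e → end b i ≢ v
    index b v with any? (λ i → end b i ≟ v)
    ... | yes (e , refl) = e , λ i i≢e q → i≢e (end-injective b q)
    -- Here `v` is not an end on this side, so the excluded index is arbitrary.
    ... | no none = zero , λ i _ q → none (i , q)

    avoid : ∀ b u c v d w → ∃ λ i → end b i ≢ u × end c i ≢ v × end d i ≢ w
    avoid b u c v d w with index b u | index c v | index d w
    ... | e , p | f , q | g , r with avoid-three e f g
    ...   | i , i≢e , i≢f , i≢g = i , p i i≢e , q i i≢f , r i i≢g

    -- Membership in side `b` is tested against `S zero` alone; `far-all` extends it to all four
    -- sets.
    Far : Bool → Fin m → Set
    Far b v = ¬ v ~ a × v ≢ a × (v ≡ end b zero ⊎ v ~ end (not b) zero)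

    -- When `v` is adjacent to `end (not b) zero`, it cannot be adjacent to `end b j`, which has
    -- that neighbour too; so only `end (not b) j` can dominate it in `S j`.
    far-all : ∀ b {v} → Far b v → ∀ j → v ≢ end b j → v ~ end (not b) j
    far-all b {v} (v≁a , v≢a , cond) j v≢ with j ≟ zero | cond
    ... | yes refl | inj₁ e = ⊥-elim (v≢ e)
    ... | yes refl | inj₂ e = e
    ... | no j≢0 | inj₁ refl = crown b (≢-sym j≢0)
    ... | no j≢0 | inj₂ v~0 = Triple.via-z (ends b j) (Triple.outside-T (ends b j) v≢a v≢ v≢opp) v≁a
            λ v~e → triangle v~e (crown b j≢0) (~-sym v~0)
      where
      v≢opp : v ≢ end (not b) j
      v≢opp refl with avoid-three zero j j
      ... | l , l≢0 , l≢j , _ = triangle v~0 (~-sym (crown b l≢0)) (crown b l≢j)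

    Spec : Place → Fin m → Set
    Spec apex     v = v ≡ a
    Spec nbr      v = v ~ a
    Spec (side b) v = Far b v

    locate : ∀ v → ∃ λ l → Spec l v
    locate v with v ≟ a | v ~? a
    ... | yes v≡a | _ = apex , v≡a
    ... | no _ | yes v~a = nbr , v~a
    ... | no v≢a | no v≁a with v ≟ y₀ | v ≟ z₀ 
    ...   | yes v≡y | _ = side true , v≁a , v≢a , inj₁ v≡y
    ...   | no _ | yes v≡z = side false , v≁a , v≢a , inj₁ v≡z
    ...   | no v≢y | no v≢z with Triple.dominated t₀ (Triple.outside-T t₀ v≢a v≢y v≢z)
    ...     | inj₁ v~a = ⊥-elim (v≁a v~a)
    ...     | inj₂ (inj₁ v~y) = side false , v≁a , v≢a , inj₂ v~y
    ...     | inj₂ (inj₂ v~z) = side true , v≁a , v≢a , inj₂ v~z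

    place : Fin m → Place
    place v = proj₁ (locate v)

    spec : ∀ {v l} → place v ≡ l → Spec l v
    spec {v} e = subst (λ l → Spec l v) e (proj₂ (locate v))

    place-a : place a ≡ apex
    place-a = go (place a) refl
      where
      go : ∀ l → place a ≡ l → place a ≡ apex
      go apex     e = e
      go nbr      e = ⊥-elim (~-irrefl (spec e))
      go (side b) e = ⊥-elim (proj₁ (proj₂ (spec e)) refl)

    -- For an index whose end on side `b` is neither `u` nor `v`, the opposite end is adjacent to
    -- both.
    stable-far : ∀ b → Stable (Far b)
    stable-far b {u} {v} fu fv u~v with avoid b u b v b v
    ... | i , i≢u , i≢v , _ = triangle u~v (far-all b fv i (≢-sym i≢v)) (~-sym (far-all b fu i (≢-sym i≢u)))

    far-end : ∀ b i → Far b (end b i)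
    far-end b i with i ≟ zero
    ... | yes refl = end≁a b i , end≢a b i , inj₁ refl
    ... | no i≢0   = end≁a b i , end≢a b i , inj₂ (crown b i≢0)

    -- On side `b` this end would be adjacent to another `end b j`, contradicting `stable-far`.
    wrong-side : ∀ b i → place (end (not b) i) ≢ side b
    wrong-side b i e with avoid-three i i i
    ... | j , j≢i , _ = stable-far b (spec e) (far-end b j) (~-sym (crown b j≢i))

    place-end : ∀ b i → place (end b i) ≡ side b
    place-end b i = go b (place (end b i)) refl
      where
      go : ∀ b l → place (end b i) ≡ l → place (end b i) ≡ side b
      go b     apex         e = ⊥-elim (end≢a b i (spec e))
      go b     nbr          e = ⊥-elim (end≁a b i (spec e))
      go true  (side true)  e = e
      go false (side false) e = e
      go true  (side false) e = ⊥-elim (wrong-side false i e)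
      go false (side true)  e = ⊥-elim (wrong-side true i e)

    -- Some crown end avoids both exceptions and is adjacent to `u`. Given a neighbour `z` of `u` on
    -- the other side, the index can also be chosen so that `z` is adjacent to that end, closing a
    -- triangle.
    full : ∀ b {u x x′} → (∀ {y} → place y ≡ side b → y ≢ x → y ≢ x′ → y ~ u) →
      (∃ λ y → place y ≡ side b × y ~ u) × (∀ {z} → place z ≡ side (not b) → ¬ z ~ u)
    full b {u} {x} {x′} h = first (avoid b x b x′ b x) , second
      where
      first : ∃ (λ i → end b i ≢ x × end b i ≢ x′ × end b i ≢ x) → ∃ λ y → place y ≡ side b × y ~ u
      first (i , i≢x , i≢x′ , _) = end b i , place-end b i , h (place-end b i) i≢x i≢x′

      second : ∀ {z} → place z ≡ side (not b) → ¬ z ~ u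
      second {z} zₛ z~u with avoid b x b x′ (not b) z
      ... | i , i≢x , i≢x′ , i≢z = triangle z~u (~-sym (h (place-end b i) i≢x i≢x′))
              (~-sym (subst (λ c → z ~ end c i) (Bool.not-involutive b) (far-all (not b) (spec zₛ) i (≢-sym i≢z))))

    open Bipartition a place place-a spec spec (λ e → proj₁ (spec e))
      (λ b uₛ vₛ → stable-far b (spec uₛ) (spec vₛ)) full public using (module Charging)

  -- Two sets with a common pair leave few non-neighbours.

  complete₂ : ∀ {T x y} → Good T → x ∈ T → y ∈ T → x ≢ y → ∃ λ z → Triple T x y z
  complete₂ good x∈ y∈ x≢y with complete good x∈
  ... | p , q , t with Triple.only t y∈
  ...   | inj₁ refl = ⊥-elim (x≢y refl)
  ...   | inj₂ (inj₁ refl) = q , t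
  ...   | inj₂ (inj₂ refl) = p , swap₂₃ t

  same-triple : ∀ {T T′ x y z} → Triple T x y z → Triple T′ x y z → T ≡ T′
  same-triple {x = x} t t′ = agree₁ (_≡ x) (λ { refl refl → ~-irrefl }) t t′ refl refl

  -- N(a) is independent, so a set is determined by its trace on the listed vertices, coded as `k`
  -- bits.
  few-non-neighbours : ∀ {k} (a : Fin m) (w : Fin k → Fin m) → (∀ v → ¬ v ~ a → ∃ λ i → v ≡ w i) →
    ∀ {F} → Unique F → All Good F → length F ≤ 2 ^ k
  few-non-neighbours {k} a w listed =
    length≤-by-injection Good (λ T c → code T ≡ c) (λ {T} _ → code T , refl) injective
    where
    bit : Bool → Fin 2
    bit false = zero
    bit true  = suc zero

    bit-injective : ∀ {b c} → bit b ≡ bit c → b ≡ c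
    bit-injective {false} {false} _ = refl
    bit-injective {true}  {true}  _ = refl

    bits : Subset m → Fin k → Fin 2
    bits T i = bit (lookup T (w i))

    code : Subset m → Fin (2 ^ k)
    code T = funToFin (bits T)

    decode : ∀ {T T′} → code T ≡ code T′ → ∀ i → lookup T (w i) ≡ lookup T′ (w i)
    decode {T} {T′} e i = bit-injective (trans (sym (finToFun-funToFin (bits T) i))
      (trans (cong (λ c → finToFun c i) e) (finToFun-funToFin (bits T′) i)))

    transfer : ∀ {T T′} → code T ≡ code T′ → ∀ {v} → ¬ v ~ a → v ∈ T → v ∈ T′
    transfer {T} {T′} e {v} v≁a v∈ with listed v v≁a
    ... | i , refl = lookup⇒[]= (w i) T′ (trans (sym (decode {T} {T′} e i)) ([]=⇒lookup v∈))

    injective : ∀ {T T′ c} → Good T → Good T′ → code T ≡ c → code T′ ≡ c → T ≡ T′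
    injective (max , _) (max′ , _) e e′ = determined (_~ a) (λ u~a v~a u~v → triangle u~v v~a (~-sym u~a)) max max′
      (transfer (trans e (sym e′))) (transfer (trans e′ (sym e)))

  module SharedPair {a y z z′ : Fin m} {T₁ T₂ : Subset m} (t₁ : Triple T₁ a y z) (t₂ : Triple T₂ a y z′)
    (T₁≢T₂ : T₁ ≢ T₂) where

    z≢z′ : z ≢ z′
    z≢z′ refl = T₁≢T₂ (same-triple t₁ t₂)

    z~z′ : z ~ z′
    z~z′ = Triple.via-z t₂ (Triple.outside-T t₂ (≢-sym (Triple.x≢z t₁)) (≢-sym (Triple.y≢z t₁)) z≢z′)
      (λ e → Triple.x≁z t₁ (~-sym e)) (λ e → Triple.y≁z t₁ (~-sym e))

    record Rest (v : Fin m) : Set where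
      constructor rest
      field
        ≁a  : ¬ v ~ a
        ≢a  : v ≢ a
        ≢y  : v ≢ y
        ≢z  : v ≢ z
        ≢z′ : v ≢ z′
    open Rest

    -- Otherwise `T₁` and `T₂` make `v` adjacent to both `z` and `z′`, which are adjacent.
    rest~y : ∀ {v} → Rest v → v ~ y
    rest~y {v} r with v ~? y
    ... | yes v~y = v~y
    ... | no v≁y = ⊥-elim (triangle
            (Triple.via-z t₁ (Triple.outside-T t₁ (≢a r) (≢y r) (≢z r)) (≁a r) v≁y)
            z~z′
            (~-sym (Triple.via-z t₂ (Triple.outside-T t₂ (≢a r) (≢y r) (≢z′ r)) (≁a r) v≁y)))

    rest-stable : Stable Rest
    rest-stable ru rv u~v = triangle u~v (rest~y rv) (~-sym (rest~y ru))

    Exhausted : Set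
    Exhausted = ∃₂ λ p q → ∀ {v} → Rest v → v ≡ p ⊎ v ≡ q

    exhausted : ∀ {p q} → (∀ {v} → Rest v → v ≢ p → v ≢ q → ⊥) → Exhausted
    exhausted {p} {q} h = p , q , λ {v} r → go r (v ≟ p) (v ≟ q)
      where
      go : ∀ {v} → Rest v → Dec (v ≡ p) → Dec (v ≡ q) → v ≡ p ⊎ v ≡ q
      go r (yes e) _       = inj₁ e
      go r (no _)  (yes e) = inj₂ e
      go r (no ne) (no nf) = ⊥-elim (h r ne nf)

    Attached : Fin m → Subset m → Set
    Attached x S = ∃ λ p → Triple S a x p × Rest p × (∀ {v} → Rest v → v ≢ p → v ~ x)

    attached : ∀ {S p x} → Triple S a x p → Rest p → (∀ {v} → Rest v → v ≢ x) → Attached x S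
    attached {p = p} t rp ≢x = p , t , rp , λ rv v≢p →
      Triple.via-y t (Triple.outside-T t (≢a rv) (≢x rv) v≢p) (≁a rv) (rest-stable rv rp)

    third-rest : ∀ {S x p} → Triple S a x p → p ≢ y → p ≢ z → p ≢ z′ → Rest p
    third-rest t = rest (λ e → Triple.x≁z t (~-sym e)) (≢-sym (Triple.x≢z t))

    -- The third vertex of such a set would be neither `z` nor `z′`, hence in `Rest` and adjacent to
    -- `y`.
    y∉ : ∀ {S} → Good S → a ∈ S → S ≢ T₁ → S ≢ T₂ → y ∉ S
    y∉ good a∈ S≢T₁ S≢T₂ y∈ with complete₂ good a∈ y∈ (Triple.x≢y t₁)
    ... | p , t = Triple.y≁z t (~-sym (rest~y (third-rest t (≢-sym (Triple.y≢z t))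
                    (λ { refl → S≢T₁ (same-triple t t₁) }) (λ { refl → S≢T₂ (same-triple t t₂) }))))

    -- A set avoiding `z` and `z′` is `a` with two vertices of `Rest`; since `Rest` is independent,
    -- these dominate no further vertex of it, so there is none.
    classify : ∀ {S} → Good S → a ∈ S → S ≢ T₁ → S ≢ T₂ → Exhausted ⊎ Attached z S ⊎ Attached z′ S
    classify {S} good a∈ S≢T₁ S≢T₂ with z ∈? S | z′ ∈? S
    ... | yes z∈ | _ with complete₂ good a∈ z∈ (Triple.x≢z t₁)
    ...   | p , t = inj₂ (inj₁ (attached t
              (third-rest t (λ { refl → y∉S (Triple.z∈ t) }) (≢-sym (Triple.y≢z t)) (λ { refl → Triple.y≁z t z~z′ })) ≢z))
      where y∉S = y∉ good a∈ S≢T₁ S≢T₂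
    classify {S} good a∈ S≢T₁ S≢T₂ | no z∉ | yes z′∈ with complete₂ good a∈ z′∈ (Triple.x≢z t₂)
    ...   | p , t = inj₂ (inj₂ (attached t
              (third-rest t (λ { refl → y∉S (Triple.z∈ t) }) (λ { refl → z∉ (Triple.z∈ t) }) (≢-sym (Triple.y≢z t))) ≢z′))
      where y∉S = y∉ good a∈ S≢T₁ S≢T₂
    classify {S} good a∈ S≢T₁ S≢T₂ | no z∉ | no z′∉ with complete good a∈
    ...   | p , q , t = inj₁ (exhausted λ {v} rv v≢p v≢q → nowhere rv
              (Triple.dominated t (Triple.outside-T t (≢a rv) v≢p v≢q)))
      where
      y∉S = y∉ good a∈ S≢T₁ S≢T₂
      rp : Rest p
      rp = third-rest (swap₂₃ t) (λ { refl → y∉S (Triple.y∈ t) }) (λ { refl → z∉ (Triple.y∈ t) }) (λ { refl → z′∉ (Triple.y∈ t) })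
      rq : Rest q
      rq = third-rest t (λ { refl → y∉S (Triple.z∈ t) }) (λ { refl → z∉ (Triple.z∈ t) }) (λ { refl → z′∉ (Triple.z∈ t) })
      nowhere : ∀ {v} → Rest v → v ~ a ⊎ v ~ p ⊎ v ~ q → ⊥
      nowhere rv (inj₁ e) = ≁a rv e
      nowhere rv (inj₂ (inj₁ e)) = rest-stable rv rp e
      nowhere rv (inj₂ (inj₂ e)) = rest-stable rv rq e

    attached-unique : ∀ {x S S′} {X : Set} → S ≢ S′ → Attached x S → Attached x S′ → X
    attached-unique S≢S′ (p , t , _ , h) (p′ , t′ , rp′ , _) with p′ ≟ p
    ... | yes refl = ⊥-elim (S≢S′ (same-triple t t′))
    ... | no ne = ⊥-elim (Triple.y≁z t′ (~-sym (h rp′ ne)))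

    -- A further vertex of `Rest` would be adjacent to both ends of the edge from `z` to `z′`.
    attached-both : ∀ {S S′} → Attached z S → Attached z′ S′ → Exhausted
    attached-both (p , _ , _ , h) (p′ , _ , _ , h′) =
      exhausted λ rv v≢p v≢p′ → triangle (h rv v≢p) z~z′ (~-sym (h′ rv v≢p′))

    rest-exhausted : ∀ {S S′} → Good S → a ∈ S → S ≢ T₁ → S ≢ T₂ → Good S′ → a ∈ S′ → S′ ≢ T₁ → S′ ≢ T₂ →
      S ≢ S′ → Exhausted
    rest-exhausted g a∈ n₁ n₂ g′ a∈′ n₁′ n₂′ S≢S′ with classify g a∈ n₁ n₂ | classify g′ a∈′ n₁′ n₂′
    ... | inj₁ e | _ = e
    ... | _ | inj₁ e = e
    ... | inj₂ (inj₁ p) | inj₂ (inj₁ p′) = attached-unique S≢S′ p p′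
    ... | inj₂ (inj₂ p) | inj₂ (inj₂ p′) = attached-unique S≢S′ p p′
    ... | inj₂ (inj₁ p) | inj₂ (inj₂ p′) = attached-both p p′
    ... | inj₂ (inj₂ p) | inj₂ (inj₁ p′) = attached-both p′ p

    bounded : Exhausted → ∀ {F} → Unique F → All Good F → length F ≤ 64
    bounded (p , q , only) = few-non-neighbours a (lookup (a ∷ y ∷ z ∷ z′ ∷ p ∷ q ∷ [])) listed
      where
      listed : ∀ v → ¬ v ~ a → ∃ λ i → v ≡ lookup (a ∷ y ∷ z ∷ z′ ∷ p ∷ q ∷ []) i
      listed v v≁a with v ≟ a | v ≟ y | v ≟ z | v ≟ z′
      ... | yes e | _ | _ | _ = zero , e
      ... | no _ | yes e | _ | _ = suc zero , e
      ... | no _ | no _ | yes e | _ = suc (suc zero) , e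
      ... | no _ | no _ | no _ | yes e = suc (suc (suc zero)) , e
      ... | no n₁ | no n₂ | no n₃ | no n₄ with only (rest v≁a n₁ n₂ n₃ n₄)
      ...   | inj₁ e = suc (suc (suc (suc zero))) , e
      ...   | inj₂ e = suc (suc (suc (suc (suc zero)))) , e

  -- The upper bound from vertex degrees.

  Shares : Fin m → Subset m → Subset m → Set
  Shares a T T′ = ∃ λ y → y ≢ a × y ∈ T × y ∈ T′

  shares? : ∀ a T T′ → Dec (Shares a T T′)
  shares? a T T′ = any? λ y → ¬? (y ≟ a) ×-dec ((y ∈? T) ×-dec (y ∈? T′))

  shared-bound : ∀ {a T₁ T₂ S S′} → Good T₁ → Good T₂ → Good S → Good S′ → a ∈ T₁ → a ∈ T₂ → a ∈ S → a ∈ S′ →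
    T₁ ≢ T₂ → S ≢ T₁ → S ≢ T₂ → S′ ≢ T₁ → S′ ≢ T₂ → S ≢ S′ → Shares a T₁ T₂ →
    ∀ {F} → Unique F → All Good F → length F ≤ 64
  shared-bound g₁ g₂ g g′ a∈₁ a∈₂ a∈ a∈′ ne n₁ n₂ n₁′ n₂′ S≢S′ (y , y≢a , y∈₁ , y∈₂)
    with _ , t₁ ← complete₂ g₁ a∈₁ y∈₁ (≢-sym y≢a)
    with _ , t₂ ← complete₂ g₂ a∈₂ y∈₂ (≢-sym y≢a)
    = bounded (rest-exhausted g a∈ n₁ n₂ g′ a∈′ n₁′ n₂′ S≢S′)
    where open SharedPair t₁ t₂ ne

  heavy-bound : ∀ {a} (S : Fin 4 → Subset m) → (∀ i → Good (S i)) → (∀ i → a ∈ S i) →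
    (∀ {i j} → S i ≡ S j → i ≡ j) → ∀ {F} → Unique F → All Good F → length F ≤ m + 64
  heavy-bound {a} S good a∈ S-injective unique allGood
    with any? (λ i → any? λ j → ¬? (i ≟ j) ×-dec shares? a (S i) (S j))
  ... | no none = ≤-trans (Crown.Charging.size≤m a S good a∈ disjoint _ allGood unique) (m≤m+n m 64)
    where
    disjoint : ∀ {i j v} → i ≢ j → v ∈ S i → v ∈ S j → v ≡ a
    disjoint {i} {j} {v} i≢j v∈ v∈′ with v ≟ a
    ... | yes e = e
    ... | no ne = ⊥-elim (none (i , j , i≢j , v , ne , v∈ , v∈′))
  ... | yes (i , j , i≢j , sh) with avoid-three i j j
  ...   | k , k≢i , k≢j , _ with avoid-three i j k
  ...     | l , l≢i , l≢j , l≢k = ≤-trans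
            (shared-bound (good i) (good j) (good k) (good l) (a∈ i) (a∈ j) (a∈ k) (a∈ l)
              (apart i≢j) (apart k≢i) (apart k≢j) (apart l≢i) (apart l≢j) (apart (≢-sym l≢k)) sh unique allGood)
            (m≤n+m 64 m)
    where
    apart : ∀ {i j} → i ≢ j → S i ≢ S j
    apart i≢j e = i≢j (S-injective e)

  four-distinct : ∀ {a} L → Unique L → All Good L → All (a ∈_) L → 4 ≤ length L →
    ∃ λ (S : Fin 4 → Subset m) → (∀ i → Good (S i)) × (∀ i → a ∈ S i) × (∀ {i j} → S i ≡ S j → i ≡ j)
  four-distinct {a} L unique good a∈ 4≤ =
    (λ i → List.lookup L (inject≤ i 4≤)) , (λ i → lookup-member good _) , (λ i → lookup-member a∈ _)
    , λ e → inject≤-injective 4≤ 4≤ _ _ (Unique⇒lookup-injective unique e)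

  upper-bound : ∀ {F} → Unique F → All Good F → length F ≤ m + 64
  upper-bound {F} unique allGood with all? (λ v → degree F v ≤? 3)
  ... | yes light = ≤-trans
          -- Set size and degree bound are both 3, so the factor cancels.
          (*-cancelʳ-≤ (length F) m 3 (≤-trans (≤-reflexive (sym (∑-const F (All.map proj₂ allGood)))) (∑∣S∣≤m*d F light)))
          (m≤m+n m 64)
  ... | no ¬light with ¬∀⟶∃¬ m _ (λ v → degree F v ≤? 3) ¬light
  ...   | a , heavy with four-distinct (filter (a ∈?_) F) (Unique.filter⁺ (a ∈?_) unique)
                         (All.filter⁺ (a ∈?_) allGood) (All.all-filter (a ∈?_) F) (≰⇒> heavy)
  ...     | S , good , a∈ , injective = heavy-bound S good a∈ injective unique allGood

theorem37 : ∃ λ (C : ℕ) → ∃ λ (M : ℕ) → ∀ (m : ℕ) → M ≤ m →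
    (∀ (X : System′ 3 m) → length (family X) ≤ m + C)
    × (∃ λ (X : System′ 3 m) → m ≤ length (family X) + C)
-- 64 is `2 ^ 6`, from `a` and at most five other vertices not adjacent to it; `m` at least 2 lets
-- it be written `2 + k`, with `k` intervals.
theorem37 = 64 , 2 , bounds
  where
  bounds : ∀ m → 2 ≤ m →
    (∀ (X : System′ 3 m) → length (family X) ≤ m + 64) × (∃ λ (X : System′ 3 m) → m ≤ length (family X) + 64)
  bounds (suc (suc k)) (s≤s (s≤s z≤n)) =
    (λ X → Triples.upper-bound (graph X) (triFree X) (distinct X) (All.zip (maxIndep X , sizes X)))
    , intervalSystem k , lower
    where
    lower : 2 + k ≤ length (family (intervalSystem k)) + 64
    lower rewrite length-tabulate (interval {k}) = ≤-trans (≤-reflexive (+-comm 2 k)) (+-monoʳ-≤ k (s≤s (s≤s z≤n)))
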